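{- There exist a constant $C$ and infinitely many (pairwise non-isomorphic) finite simple $2$-vertex-connected cubic graphs $G$, each having an edge $st\in E(G)$ such that $$\mathrm{OPT}(G,s,t)\ge \tfrac54|V(G)|-C.$$ In particular, for every real $\alpha<5/4$ and every constant $C'$, it is not true that $\mathrm{OPT}(G,s,t)\le\alpha|V(G)|+C'$ for all finite simple $2$-connected cubic graphs $G$ and all distinct $s,t\in V(G)$ (hence such a bound also fails for the class of all simple $2$-connected subcubic graphs).
   Context: A graph is cubic if every vertex has degree $3$, and subcubic if its maximum degree is at most $3$. "$2$-connected" means $2$-vertex-connected. For a connected graph $G$ and distinct vertices $s,t$, $\mathrm{OPT}(G,s,t)$ is the length (number of edges, counted with repetition) of a shortest walk in $G$ from $s$ to $t$ that visits every vertex of $G$ (vertices and edges may be repeated). Equivalently, it is the minimum number of edges of a connected spanning multigraph on $V(G)$ whose edges are copies of edges of $G$ and whose set of odd-degree vertices is exactly $\{s,t\}$. -}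

module Defs where

open import Data.Fin.Base using (Fin)
open import Data.Fin.Subset using (Subset; ∣_∣; _∈_; _∉_)
open import Data.Integer.Base using (+_)
open import Data.List.Base using (List; []; _∷_)
open import Data.List.Membership.Propositional using () renaming (_∈_ to _∈ˡ_)
open import Data.List.Relation.Unary.All using (All)
open import Data.Nat.Base as ℕ using (ℕ; zero; suc)
import Data.Nat.Properties as ℕ
open import Data.Product.Base using (Σ; ∃; _×_; _,_)
open import Data.Rational.Base as ℚ using (ℚ; 0ℚ; ½)
import Data.Rational.Properties as ℚ
import Data.Rational.Solver as ℚ
open import Function.Bundles using (_↔_; _⇔_; Inverse)
open import Relation.Binary.Construct.Closure.ReflexiveTransitive using (Star; ε; _◅_)
open import Relation.Binary.PropositionalEquality using (_≡_; _≢_; refl; cong; subst; sym)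

record Graph : Set where
  field
    order       : ℕ
    neighbours  : Fin order → Subset order
    symmetric   : ∀ {u v} → v ∈ neighbours u → u ∈ neighbours v
    irreflexive : ∀ v → v ∉ neighbours v

  Vertex : Set
  Vertex = Fin order

  Adjacent : Vertex → Vertex → Set
  Adjacent u v = v ∈ neighbours u

  degree : Vertex → ℕ
  degree v = ∣ neighbours v ∣

  Walk : Vertex → Vertex → Set
  Walk = Star Adjacent

  length : ∀ {u v} → Walk u v → ℕ
  length ε       = 0
  length (_ ◅ p) = suc (length p)

  vertices : ∀ {u v} → Walk u v → List Vertex
  vertices {u} ε       = u ∷ []
  vertices {u} (_ ◅ p) = u ∷ vertices p

  Spanning : ∀ {u v} → Walk u v → Set
  Spanning p = ∀ x → x ∈ˡ vertices p

open Graph public using (order; Vertex)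

_≅_ : Graph → Graph → Set
G ≅ H = Σ (Vertex G ↔ Vertex H) λ f →
  ∀ u v → Graph.Adjacent G u v ⇔ Graph.Adjacent H (Inverse.to f u) (Inverse.to f v)

Cubic : Graph → Set
Cubic G = ∀ v → Graph.degree G v ≡ 3

Subcubic : Graph → Set
Subcubic G = ∀ v → Graph.degree G v ℕ.≤ 3

-- G has more than k vertices and G − X is connected for every set X of fewer
-- than k vertices; a walk in G − X is a walk in G with no vertex in X.
VertexConnected : ℕ → Graph → Set
VertexConnected k G =
  k ℕ.< order G ×
  (∀ (X : Subset (order G)) → ∣ X ∣ ℕ.< k → ∀ u v → u ∉ X → v ∉ X →
    Σ (Graph.Walk G u v) λ p → All (_∉ X) (Graph.vertices G p))

-- The relation OPT(G,s,t) = k; minimality makes k unique.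
IsOPT : (G : Graph) → Vertex G → Vertex G → ℕ → Set
IsOPT G s t k =
  (Σ (Walk s t) λ p → Spanning p × length p ≡ k) ×
  (∀ (p : Walk s t) → Spanning p → k ℕ.≤ length p)
  where open Graph G

fromℕ : ℕ → ℚ
fromℕ n = + n ℚ./ 1

-- Different sequences may represent the same real; _<ᴿ_ and _≤ᴿ_ do not
-- depend on the representatives.
record ℝ : Set where
  field
    seq    : ℕ → ℚ
    cauchy : ∀ δ → 0ℚ ℚ.< δ → ∃ λ N → ∀ m n → N ℕ.≤ m → N ℕ.≤ n →
             ℚ.∣ seq m ℚ.- seq n ∣ ℚ.≤ δ

open ℝ public

fromℚ : ℚ → ℝ
fromℚ q .seq    _     = q
fromℚ q .cauchy δ 0<δ = 0 , λ _ _ _ _ →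
  subst (ℚ._≤ δ) (cong ℚ.∣_∣ {x = 0ℚ} (sym (ℚ.+-inverseʳ q))) (ℚ.<⇒≤ 0<δ)

infix  4 _<ᴿ_ _≤ᴿ_
infixl 6 _+ᴿ_
infixr 7 _·_

_<ᴿ_ : ℝ → ℝ → Set
x <ᴿ y = ∃ λ δ → 0ℚ ℚ.< δ × ∃ λ N → ∀ n → N ℕ.≤ n → seq x n ℚ.+ δ ℚ.≤ seq y n

_≤ᴿ_ : ℝ → ℝ → Set
x ≤ᴿ y = ∀ δ → 0ℚ ℚ.< δ → ∃ λ N → ∀ n → N ℕ.≤ n → seq x n ℚ.≤ seq y n ℚ.+ δ

_+ᴿ_ : ℝ → ℝ → ℝ
(x +ᴿ y) .seq n = seq x n ℚ.+ seq y n
(x +ᴿ y) .cauchy δ 0<δ with cauchy x (½ ℚ.* δ) 0<½δ | cauchy y (½ ℚ.* δ) 0<½δ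
  where
  0<½δ : 0ℚ ℚ.< ½ ℚ.* δ
  0<½δ = ℚ.*-monoʳ-<-pos ½ 0<δ
... | M , hx | N , hy = M ℕ.⊔ N , λ m n h₁ h₂ → begin
  ℚ.∣ (seq x m ℚ.+ seq y m) ℚ.- (seq x n ℚ.+ seq y n) ∣
    ≡⟨ cong ℚ.∣_∣ (regroup (seq x m) (seq y m) (seq x n) (seq y n)) ⟩
  ℚ.∣ (seq x m ℚ.- seq x n) ℚ.+ (seq y m ℚ.- seq y n) ∣
    ≤⟨ ℚ.∣p+q∣≤∣p∣+∣q∣ (seq x m ℚ.- seq x n) (seq y m ℚ.- seq y n) ⟩
  ℚ.∣ seq x m ℚ.- seq x n ∣ ℚ.+ ℚ.∣ seq y m ℚ.- seq y n ∣
    ≤⟨ ℚ.+-mono-≤ (hx m n (ℕ.m⊔n≤o⇒m≤o M N h₁) (ℕ.m⊔n≤o⇒m≤o M N h₂))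
                  (hy m n (ℕ.m⊔n≤o⇒n≤o M N h₁) (ℕ.m⊔n≤o⇒n≤o M N h₂)) ⟩
  ½ ℚ.* δ ℚ.+ ½ ℚ.* δ
    ≡⟨ ℚ.*-distribʳ-+ δ ½ ½ ⟨
  (½ ℚ.+ ½) ℚ.* δ
    ≡⟨ ℚ.*-identityˡ δ ⟩
  δ ∎
  where
  open ℚ.≤-Reasoning
  regroup : ∀ a b c d → (a ℚ.+ b) ℚ.- (c ℚ.+ d) ≡ (a ℚ.- c) ℚ.+ (b ℚ.- d)
  regroup = solve 4 (λ a b c d → (a :+ b) :- (c :+ d) := (a :- c) :+ (b :- d)) refl
    where open ℚ.+-*-Solver

_·_ : ℕ → ℝ → ℝ
zero  · x = fromℚ 0ℚ
suc n · x = x +ᴿ n · x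

OPTBound : (Graph → Set) → ℝ → ℝ → Set
OPTBound P α C =
  ∀ (G : Graph) → P G → ∀ (s t : Vertex G) → s ≢ t →
  ∀ k → IsOPT G s t k → fromℚ (fromℕ k) ≤ᴿ order G · α +ᴿ C

module Submission where

-- Call K₄ minus an edge a diamond.  The graph G i is a ladder whose rungs are
-- alternately single edges and diamonds attached by an edge at each end, closed
-- off by a diamond at either end of the ladder; it has 8i + 8 vertices.  A closed
-- spanning walk crosses every cut a positive even number of times.  The number of
-- crossings of a single edge of a 2-edge-cut costs `share`: 1 if it is odd and 2
-- if it is even.  The cut conditions give
--   a diamond and its two attaching edges:  length ≥ 4 + share of one of them,
--   a plain rung and the four rails at it:  length ≥ 2 + the shares of a left and
--                                                    a right rail,
-- and at an end of a diamond rung the shares of the three edges add up to at least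
-- 4 by parity.  Summing over the ladder, the shares cancel and the closed walk has
-- length at least 10i + 8.  A spanning walk between neighbours s and t is closed by
-- the edge ts, so OPT(G i, s, t) ≥ 10i + 7 = 5/4 |V| − 3.

open import Defs
open import Data.Bool.Base using (Bool; true; false; not; _∧_; _∨_; _xor_; if_then_else_)
open import Data.Bool.ListAction using (any)
import Data.Bool.Properties as Bool
open import Data.Fin.Base as Fin using (Fin; zero; suc; _↑ˡ_; _↑ʳ_; splitAt)
open import Data.Fin.Patterns
open import Data.Fin.Permutation using (↔⇒≡)
import Data.Fin.Properties as Fin
open import Data.Fin.Subset using (Subset; ∣_∣; _∈_; _∉_; ⊥)
import Data.Fin.Subset.Properties as Subset
import Data.Integer.Properties as ℤ
open import Data.List.Base as List using (List; []; _∷_)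
import Data.List.Membership.DecPropositional as Membership
open import Data.List.Membership.Propositional using () renaming (_∈_ to _∈ˡ_)
open import Data.List.Membership.Propositional.Properties using (∈-allFin)
open import Data.List.Relation.Unary.All using (All; []; _∷_)
open import Data.List.Relation.Unary.Any using (here; there)
open import Data.Nat.Base as ℕ using (ℕ; zero; suc; z≤n; s≤s)
import Data.Nat.Coprimality as Coprime
import Data.Nat.Induction as ℕ
open import Data.Nat.ListAction using (sum)
import Data.Nat.Properties as ℕ
open import Data.Nat.Tactic.RingSolver using (solve-∀)
open import Data.Product.Base using (∃; ∃₂; _×_; _,_; proj₁; proj₂)
import Data.Rational.Properties as ℚ
import Data.Rational.Solver as ℚ
open import Data.Sum.Base as Sum using (_⊎_; inj₁; inj₂; [_,_]′)
import Data.Vec.Base as Vec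
import Data.Vec.Properties as Vec
open import Function.Base using (_∘_; _on_; const)
open import Induction.WellFounded using (Acc; acc)
open import Relation.Binary.Construct.Closure.ReflexiveTransitive as Star using (Star; ε; _◅_; _◅◅_)
open import Relation.Binary.PropositionalEquality
  using (_≡_; _≢_; refl; sym; trans; cong; cong₂; subst; subst₂; module ≡-Reasoning)
open import Relation.Nullary.Decidable
  using (Dec; yes; no; does; True; toWitness; map′; _×-dec_; _→-dec_)
open import Relation.Nullary.Negation.Core using (¬_; contradiction)

module _ where
  open import Data.Nat.Base using (_+_; _*_; _∸_; _≤_; _<_)

  -- Arithmetic of the cut conditions

  odd : ℕ → Bool
  odd zero    = false
  odd (suc n) = not (odd n)

  odd-+ : ∀ m n → odd (m + n) ≡ odd m xor odd n
  odd-+ zero    n = refl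
  odd-+ (suc m) n = trans (cong not (odd-+ m n)) (Bool.not-distribˡ-xor (odd m) (odd n))

  share : ℕ → ℕ
  share n = if odd n then 1 else 2

  1≤share : ∀ n → 1 ≤ share n
  1≤share n with odd n
  ... | true  = s≤s z≤n
  ... | false = s≤s z≤n

  share≤2 : ∀ n → share n ≤ 2
  share≤2 n with odd n
  ... | true  = s≤s z≤n
  ... | false = s≤s (s≤s z≤n)

  even∧positive⇒≥2 : ∀ n → odd n ≡ false → n ≢ 0 → 2 ≤ n
  even∧positive⇒≥2 zero          _ n≢0 = contradiction refl n≢0
  even∧positive⇒≥2 (suc (suc n)) _ _   = s≤s (s≤s z≤n)

  -- An even sum has no odd term or exactly two, so the shares are 2, 2, 2 or 1, 1, 2 in some order.
  share-sum : ∀ x g z → odd (x + (g + z)) ≡ false → 4 ≤ share x + (share g + share z)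
  share-sum x g z e rewrite odd-+ x (g + z) | odd-+ g z with odd x | odd g | odd z
  ... | false | false | false = s≤s (s≤s (s≤s (s≤s z≤n)))
  ... | false | true  | true  = s≤s (s≤s (s≤s (s≤s z≤n)))
  ... | true  | false | true  = s≤s (s≤s (s≤s (s≤s z≤n)))
  ... | true  | true  | false = s≤s (s≤s (s≤s (s≤s z≤n)))

  -- The variables count the traversals of the edges of a diamond with ends 1, 2
  -- and middle vertices 3, 4: p = 13, q = 14, s = 23, t = 24, r = 34.  Here and
  -- below the sums are bracketed as `sum` computes them.
  diamond-interior : ∀ p q r s t →
    2 ≤ p + (s + (r + 0)) → 2 ≤ q + (t + (r + 0)) → 2 ≤ p + (q + (s + (t + 0))) →
    3 ≤ p + (q + (s + (t + (r + 0))))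
  -- The cuts around 3, around 4 and around both together contain each of the five edges exactly
  -- twice.
  diamond-interior p q r s t c₃ c₄ c₃₄ = ℕ.*-cancelˡ-≤ 2
    (subst (6 ≤_) (regroup p q r s t) (ℕ.+-mono-≤ c₃ (ℕ.+-mono-≤ c₄ c₃₄)))
    where
    regroup : ∀ p q r s t →
      p + (s + (r + 0)) + (q + (t + (r + 0)) + (p + (q + (s + (t + 0))))) ≡
      2 * (p + (q + (s + (t + (r + 0)))))
    regroup = solve-∀

  -- In addition g and h count the traversals of the edges leaving 1 and 2.
  diamond-total : ∀ g h p q r s t →
    3 ≤ p + (q + (s + (t + (r + 0)))) →
    2 ≤ g + (h + 0) → 2 ≤ g + (p + (q + 0)) → 2 ≤ h + (s + (t + 0)) →
    2 ≤ h + (p + (q + 0)) → 2 ≤ g + (s + (t + 0)) →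
    4 + share g ≤ g + (h + (p + (q + (s + (t + (r + 0))))))
  diamond-total zero h p q r s t _ ch cpq _ _ cst =
    subst (6 ≤_) (regroup h p q r s t)
      (ℕ.≤-trans (ℕ.+-mono-≤ ch (ℕ.+-mono-≤ cpq cst)) (ℕ.m≤m+n _ r))
    where
    regroup : ∀ h p q r s t →
      h + 0 + (p + (q + 0) + (s + (t + 0))) + r ≡ h + (p + (q + (s + (t + (r + 0)))))
    regroup = solve-∀
  diamond-total g@(suc _) zero p q r s t _ cg _ cst cpq _ =
    ℕ.≤-trans (ℕ.+-monoʳ-≤ 4 (share≤2 g)) (subst (6 ≤_) (regroup g p q r s t)
      (ℕ.≤-trans (ℕ.+-mono-≤ cg (ℕ.+-mono-≤ cpq cst)) (ℕ.m≤m+n _ r)))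
    where
    regroup : ∀ g p q r s t →
      g + (0 + 0) + (p + (q + 0) + (s + (t + 0))) + r ≡ g + (p + (q + (s + (t + (r + 0)))))
    regroup = solve-∀
  -- Both attaching edges are used: the interior gives 3, `h` gives 1, and `g` gives at least
  -- `share g`.
  diamond-total 1 (suc h) p q r s t i _ _ _ _ _ =
    s≤s (s≤s (ℕ.≤-trans i (ℕ.m≤n+m _ h)))
  diamond-total g@(suc (suc g′)) (suc h) p q r s t i _ _ _ _ _ =
    ℕ.≤-trans (ℕ.+-monoʳ-≤ 4 (share≤2 g)) (s≤s (s≤s (ℕ.≤-trans
      (s≤s (ℕ.≤-trans i (ℕ.m≤n+m _ h))) (ℕ.m≤n+m _ g′))))

  odd-by-parity : ∀ z r x → odd z xor (odd r xor odd x) ≡ false → odd z xor odd x ≡ true → 1 ≤ r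
  odd-by-parity z (suc r) x _ _ = s≤s z≤n
  odd-by-parity z zero    x p q = contradiction (trans (sym q) p) λ ()

  -- Rails z, w on the left and x, y on the right of a rung r.
  rung-even : ∀ z w r x y → odd z ≡ false → odd x ≡ false → odd r ≡ false →
    2 ≤ z + (w + 0) → 2 ≤ x + (y + 0) → 2 ≤ z + (r + (x + 0)) →
    2 ≤ w + (r + (y + 0)) → 2 ≤ w + (r + (x + 0)) → 2 ≤ z + (r + (y + 0)) →
    6 ≤ z + (w + (r + (x + (y + 0))))
  -- A used even rung adds 2 to the 4 that the two pairs of rails give.
  rung-even z w r@(suc _) x y _ _ er c₀ c₃ _ _ _ _ =
    subst (6 ≤_) (regroup z w r x y)
      (ℕ.+-mono-≤ (ℕ.+-mono-≤ c₀ c₃) (even∧positive⇒≥2 r er λ ()))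
    where
    regroup : ∀ z w r x y → z + (w + 0) + (x + (y + 0)) + r ≡ z + (w + (r + (x + (y + 0))))
    regroup = solve-∀
  rung-even zero w zero x y _ _ _ c₀ _ c₁ _ _ c₀₂ =
    subst (6 ≤_) (regroup w x y) (ℕ.+-mono-≤ c₀ (ℕ.+-mono-≤ c₁ c₀₂))
    where
    regroup : ∀ w x y → w + 0 + (x + 0 + (y + 0)) ≡ w + (x + (y + 0))
    regroup = solve-∀
  rung-even z@(suc _) w zero zero y ez _ _ _ c₃ _ _ c₀₁ _ =
    subst (6 ≤_) (regroup z w y)
      (ℕ.+-mono-≤ (even∧positive⇒≥2 z ez λ ()) (ℕ.+-mono-≤ c₀₁ c₃))
    where
    regroup : ∀ z w y → z + (w + 0 + (y + 0)) ≡ z + (w + (y + 0))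
    regroup = solve-∀
  rung-even z@(suc _) w zero x@(suc _) y ez ex _ _ _ _ c₂ _ _ =
    subst (6 ≤_) (regroup z w x y)
      (ℕ.+-mono-≤ (even∧positive⇒≥2 z ez λ ())
        (ℕ.+-mono-≤ (even∧positive⇒≥2 x ex λ ()) c₂))
    where
    regroup : ∀ z w x y → z + (x + (w + (y + 0))) ≡ z + (w + (x + (y + 0)))
    regroup = solve-∀

  -- The rail cuts give 4, which suffices if `z` and `x` are both odd. If exactly one is odd, 5 is
  -- needed and parity forces a use of the rung. If both are even, 6 is needed and `r` is even too.
  rung-total : ∀ z w r x y →
    odd (z + (r + (x + 0))) ≡ false →
    2 ≤ z + (w + 0) → 2 ≤ x + (y + 0) → 2 ≤ z + (r + (x + 0)) →
    2 ≤ w + (r + (y + 0)) → 2 ≤ w + (r + (x + 0)) → 2 ≤ z + (r + (y + 0)) →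
    2 + (share z + share x) ≤ z + (w + (r + (x + (y + 0))))
  rung-total z w r x y even₁ c₀ c₃ c₁ c₂ c₀₁ c₀₂ = cases (odd z) (odd x) refl refl
    where
    regroup : ∀ z w r x y → z + (w + 0) + (x + (y + 0)) + r ≡ z + (w + (r + (x + (y + 0))))
    regroup = solve-∀

    rails : ∀ {k} → k ≤ r → 4 + k ≤ z + (w + (r + (x + (y + 0))))
    rails {k} k≤r = subst (4 + k ≤_) (regroup z w r x y) (ℕ.+-mono-≤ (ℕ.+-mono-≤ c₀ c₃) k≤r)

    parity : odd z xor (odd r xor odd x) ≡ false
    parity = trans (sym (trans (odd-+ z (r + (x + 0))) (cong (odd z xor_)
      (trans (odd-+ r (x + 0)) (cong (λ k → odd r xor odd k) (ℕ.+-identityʳ x)))))) even₁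

    cases : ∀ a b → odd z ≡ a → odd x ≡ b →
      2 + (share z + share x) ≤ z + (w + (r + (x + (y + 0))))
    cases true  true  ez ex rewrite ez | ex = rails z≤n
    cases true  false ez ex rewrite ez | ex = rails (odd-by-parity z r x parity (cong₂ _xor_ ez ex))
    cases false true  ez ex rewrite ez | ex = rails (odd-by-parity z r x parity (cong₂ _xor_ ez ex))
    cases false false ez ex rewrite ez | ex =
      rung-even z w r x y ez ex (trans (sym r-even) parity) c₀ c₃ c₁ c₂ c₀₁ c₀₂
      where
      r-even : odd z xor (odd r xor odd x) ≡ odd r
      r-even rewrite ez | ex = Bool.xor-identityʳ (odd r)

  -- Weights of closed spanning walks

  Adjacency : ℕ → Set
  Adjacency n = Fin n → Fin n → Bool

  infix 8 _==_
  _==_ : ∀ {n} → Fin n → Fin n → Bool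
  u == v = does (u Fin.≟ v)

  Edges : ℕ → Set
  Edges n = List (Fin n × Fin n)

  matches : ∀ {n} → Fin n → Fin n → Fin n × Fin n → Bool
  matches u v (a , b) = (u == a) ∧ (v == b) ∨ (u == b) ∧ (v == a)

  fromEdges : ∀ {n} → Edges n → Adjacency n
  fromEdges es u v = any (matches u v) es

  -- The reflexive closure: a quotient map may contract the edge that the tour traverses.
  lax : ∀ {n} → Adjacency n → Adjacency n
  lax B u v = (u == v) ∨ B u v

  Weight : Set → Set
  Weight V = V → V → ℕ

  indicator : Bool → ℕ
  indicator b = if b then 1 else 0

  infixl 6 _⊕_
  _⊕_ : ∀ {V} → Weight V → Weight V → Weight V
  (ω ⊕ ω′) u v = ω u v + ω′ u v

  move : ∀ {n} → Weight (Fin n)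
  move u v = indicator (not (u == v))

  cut : ∀ {V : Set} → (V → Bool) → Weight V
  cut S u v = indicator (S u xor S v)

  edge : ∀ {n} → Fin n × Fin n → Weight (Fin n)
  edge e u v = indicator (matches u v e)

  total : ∀ {n} → Edges n → Weight (Fin n)
  total []       u v = 0
  total (e ∷ es) u v = edge e u v + total es u v

  among : ∀ {n} → List (Fin n) → Fin n → Bool
  among vs u = any (u ==_) vs

  boundary : ∀ {n} → List (Fin n) → Edges n → Edges n
  boundary vs = List.filterᵇ λ (a , b) → among vs a xor among vs b

  -- Equality is asked only on the steps that a walk in `B` can take or on standing still; for a
  -- concrete `B` it is decided by enumeration.
  Agree : ∀ {n} → Adjacency n → Weight (Fin n) → Weight (Fin n) → Set
  Agree B ω ω′ = ∀ u v → lax B u v ≡ true → ω u v ≡ ω′ u v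

  agree? : ∀ {n} (B : Adjacency n) ω ω′ → Dec (Agree B ω ω′)
  agree? B ω ω′ = Fin.all? λ u → Fin.all? λ v → (lax B u v Bool.≟ true) →-dec (ω u v ℕ.≟ ω′ u v)

  module _ (Γ : Graph) where
    open Graph Γ hiding (order; Vertex)

    weight : Weight (Vertex Γ) → ∀ {u v} → Walk u v → ℕ
    weight ω ε                   = 0
    weight ω (_◅_ {u} {v} _ p) = ω u v + weight ω p

    weight-⊕ : ∀ ω ω′ {u v} (p : Walk u v) → weight (ω ⊕ ω′) p ≡ weight ω p + weight ω′ p
    weight-⊕ ω ω′ ε = refl
    weight-⊕ ω ω′ (_◅_ {u} {v} _ p) rewrite weight-⊕ ω ω′ p =
      regroup (ω u v) (ω′ u v) (weight ω p) (weight ω′ p)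
      where
      regroup : ∀ a b c d → a + b + (c + d) ≡ a + c + (b + d)
      regroup = solve-∀

    weight-cong : ∀ {ω ω′} → (∀ u v → Adjacent u v → ω u v ≡ ω′ u v) →
                  ∀ {u v} (p : Walk u v) → weight ω p ≡ weight ω′ p
    weight-cong eq ε       = refl
    weight-cong eq (e ◅ p) = cong₂ _+_ (eq _ _ e) (weight-cong eq p)

    weight-zero : ∀ {u v} (p : Walk u v) → weight (λ _ _ → 0) p ≡ 0
    weight-zero ε       = refl
    weight-zero (_ ◅ p) = weight-zero p

    weight-one : ∀ {u v} (p : Walk u v) → weight (λ _ _ → 1) p ≡ length p
    weight-one ε       = refl
    weight-one (_ ◅ p) = cong suc (weight-one p)

    -- Each crossing changes sides, so the parity of the crossings tells whether the endpoints are
    -- separated.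
    odd-cut : ∀ S {u v} (p : Walk u v) → odd (weight (cut S) p) ≡ S u xor S v
    odd-cut S {u} ε = sym (Bool.xor-same (S u))
    odd-cut S {u} {w} (_◅_ {j = v} _ p) rewrite odd-+ (cut S u v) (weight (cut S) p) | odd-cut S p
      with S u | S v | S w
    ... | false | false | _     = refl
    ... | false | true  | false = refl
    ... | false | true  | true  = refl
    ... | true  | false | _     = refl
    ... | true  | true  | _     = refl

    uncut : ∀ S {u v} (p : Walk u v) → weight (cut S) p ≡ 0 →
            ∀ {x} → x ∈ˡ vertices p → S u ≡ S x
    uncut S ε       _ (here refl) = refl
    uncut S (_ ◅ _) _ (here refl) = refl
    uncut S {u} (_◅_ {j = v} _ p) c (there x∈p) with S u | S v | uncut S p
    ... | false | false | rec = rec c x∈p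
    ... | true  | true  | rec = rec c x∈p
    uncut S {u} (_◅_ {j = v} _ p) () (there x∈p) | false | true  | _
    uncut S {u} (_◅_ {j = v} _ p) () (there x∈p) | true  | false | _

  module Tour (Γ : Graph) {s} (p : Graph.Walk Γ s s) (spanning : Graph.Spanning Γ p) where
    open Graph Γ hiding (order; Vertex)

    ⟦_⟧ : Weight (Vertex Γ) → ℕ
    ⟦ ω ⟧ = weight Γ ω p

    even-cut : ∀ S → odd ⟦ cut S ⟧ ≡ false
    even-cut S = trans (odd-cut Γ S p) (Bool.xor-same (S s))

    -- The count is even, and it is not 0 because the tour visits both sides.
    cut≥2 : ∀ S x y → S x ≡ true → S y ≡ false → 2 ≤ ⟦ cut S ⟧
    cut≥2 S x y Sx Sy = even∧positive⇒≥2 _ (even-cut S) λ c≡0 → contradiction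
      (trans (sym Sx) (trans (sym (uncut Γ S p c≡0 (spanning x)))
        (trans (uncut Γ S p c≡0 (spanning y)) Sy))) λ ()

    -- The image of the tour under a quotient is a closed walk that may stand still.
    record Quotient {n} (B : Adjacency n) : Set where
      field
        map  : Vertex Γ → Fin n
        hom  : ∀ u v → Adjacent u v → lax B (map u) (map v) ≡ true
        onto : ∀ a → ∃ λ u → map u ≡ a

      ⟪_⟫ : Weight (Fin n) → ℕ
      ⟪ ω ⟫ = ⟦ ω on map ⟧

      count : Fin n × Fin n → ℕ
      count e = ⟪ edge e ⟫

      ⟪⟫-cong : ∀ {ω ω′} → Agree B ω ω′ → ⟪ ω ⟫ ≡ ⟪ ω′ ⟫
      ⟪⟫-cong eq = weight-cong Γ (λ u v e → eq (map u) (map v) (hom u v e)) p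

      ⟪⟫-⊕ : ∀ ω ω′ → ⟪ ω ⊕ ω′ ⟫ ≡ ⟪ ω ⟫ + ⟪ ω′ ⟫
      ⟪⟫-⊕ ω ω′ = weight-⊕ Γ (ω on map) (ω′ on map) p

      ⟪total⟫ : ∀ es → ⟪ total es ⟫ ≡ sum (List.map count es)
      ⟪total⟫ []       = weight-zero Γ p
      ⟪total⟫ (e ∷ es) = trans (⟪⟫-⊕ (edge e) (total es)) (cong (count e +_) (⟪total⟫ es))

      -- The implicit argument is filled by evaluation: on the small graph `B`, a step has weight
      -- `ω` exactly when the listed edges account for it. Summing along the tour turns this into an
      -- identity of counts.
      tally : ∀ ω es {_ : True (agree? B ω (total es))} → ⟪ ω ⟫ ≡ sum (List.map count es)
      tally ω es {ok} = trans (⟪⟫-cong (toWitness ok)) (⟪total⟫ es)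

      boundary-even : ∀ vs es {_ : True (agree? B (cut (among vs)) (total (boundary vs es)))} →
        odd (sum (List.map count (boundary vs es))) ≡ false
      boundary-even vs es {ok} = subst (λ k → odd k ≡ false)
        (tally (cut (among vs)) (boundary vs es) {ok}) (even-cut (among vs ∘ map))

      boundary≥2 : ∀ vs a b es {_ : True (agree? B (cut (among vs)) (total (boundary vs es)))} →
        among vs a ≡ true → among vs b ≡ false →
        2 ≤ sum (List.map count (boundary vs es))
      boundary≥2 vs a b es {ok} a∈ b∉ = subst (2 ≤_)
        (tally (cut (among vs)) (boundary vs es) {ok})
        (cut≥2 (among vs ∘ map) (proj₁ (onto a)) (proj₁ (onto b))
          (trans (cong (among vs) (proj₂ (onto a))) a∈)
          (trans (cong (among vs) (proj₂ (onto b))) b∉))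

  -- Diamonds and rungs

  link : ∀ {p n} → Fin p → Fin p → Fin p → Fin n → Bool
  link α β a zero          = a == α
  link α β a (suc zero)    = a == β
  link α β a (suc (suc _)) = false

  glue : ∀ {p n} → Adjacency p → Fin p → Fin p → Adjacency n → Fin p ⊎ Fin n → Fin p ⊎ Fin n → Bool
  glue P α β Y (inj₁ a) (inj₁ b) = P a b
  glue P α β Y (inj₁ a) (inj₂ y) = link α β a y
  glue P α β Y (inj₂ x) (inj₁ b) = link α β b x
  glue P α β Y (inj₂ x) (inj₂ y) = Y x y

  -- The disjoint union of P and Y with the edges α0 and β1, where 0 and 1 are the
  -- first two vertices of Y.
  join : ∀ {p n} → Adjacency p → Fin p → Fin p → Adjacency n → Adjacency (p ℕ.+ n)
  join {p} P α β Y u v = glue P α β Y (splitAt p u) (splitAt p v)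

  point : Adjacency 1
  point _ _ = false

  diamond : Adjacency 4
  diamond = fromEdges ((0F , 2F) ∷ (0F , 3F) ∷ (1F , 2F) ∷ (1F , 3F) ∷ (2F , 3F) ∷ [])

  -- A diamond on 2, 3, 4, 5 forms a rung between 0 and 1, followed by the plain
  -- rung 67; the ladder is continued at 6 and 7.
  block : Adjacency 8
  block = fromEdges
    ( (0F , 2F) ∷ (1F , 3F) ∷ (2F , 4F) ∷ (2F , 5F) ∷ (3F , 4F) ∷ (3F , 5F) ∷ (4F , 5F)
    ∷ (0F , 6F) ∷ (1F , 7F) ∷ (6F , 7F) ∷ [])

  rooted : ∀ {n} → Adjacency n → Adjacency (1 ℕ.+ n)
  rooted = join point 0F 0F

  -- Counts the moves avoiding the root, that is, the traversals of edges inside the rooted graph.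
  interior : ∀ {n} → Weight (Fin (1 ℕ.+ n))
  interior zero    _       = 0
  interior (suc _) zero    = 0
  interior (suc x) (suc y) = move x y

  isOne : ∀ {n} → Fin n → ℕ
  isOne (suc zero) = 1
  isOne _          = 0

  -- The traversals of the edge between the root and the first terminal, by pattern matching so that
  -- the weight computes on vertices of a part of unknown size.
  entry : ∀ {n} → Weight (Fin n)
  entry zero    v       = isOne v
  entry (suc u) zero    = isOne (suc u)
  entry (suc _) (suc _) = 0

  -- A diamond, with the rest of the graph contracted to 0.
  Diamond : Adjacency 5
  Diamond = rooted diamond

  rungEdges : Edges 4
  rungEdges = (0F , 1F) ∷ (0F , 2F) ∷ (1F , 2F) ∷ (1F , 3F) ∷ (2F , 3F) ∷ []

  -- A rung 12, with the parts of the ladder on its two sides contracted to 0 and 3.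
  Rung : Adjacency 4
  Rung = fromEdges rungEdges

  module Pieces (Γ : Graph) {s} (p : Graph.Walk Γ s s) (spanning : Graph.Spanning Γ p) where
    open Tour Γ p spanning

    module _ (Q : Quotient Diamond) where
      open Quotient Q

      inner outer : Edges 5
      inner = (1F , 3F) ∷ (1F , 4F) ∷ (2F , 3F) ∷ (2F , 4F) ∷ (3F , 4F) ∷ []
      outer = (0F , 1F) ∷ (0F , 2F) ∷ []

      diamond-inner : 3 ≤ ⟪ interior ⟫
      diamond-inner = subst (3 ≤_) (sym (tally interior inner))
        (diamond-interior (count (1F , 3F)) (count (1F , 4F)) (count (3F , 4F))
                          (count (2F , 3F)) (count (2F , 4F))
          (boundary≥2 (3F ∷ []) 3F 0F (outer List.++ inner) refl refl)
          (boundary≥2 (4F ∷ []) 4F 0F (outer List.++ inner) refl refl)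
          (boundary≥2 (3F ∷ 4F ∷ []) 3F 0F (outer List.++ inner) refl refl))

      diamond-all : 4 + share ⟪ entry ⟫ ≤ ⟪ move ⟫
      diamond-all = subst₂ (λ g k → 4 + share g ≤ k)
        (sym (trans (tally entry ((0F , 1F) ∷ [])) (ℕ.+-identityʳ _)))
        (sym (tally move (outer List.++ inner)))
        (diamond-total (count (0F , 1F)) (count (0F , 2F))
                       (count (1F , 3F)) (count (1F , 4F)) (count (3F , 4F))
                       (count (2F , 3F)) (count (2F , 4F))
          (subst (3 ≤_) (tally interior inner) diamond-inner)
          (boundary≥2 (0F ∷ []) 0F 1F (outer List.++ inner) refl refl)
          (boundary≥2 (1F ∷ []) 1F 0F (outer List.++ inner) refl refl)
          (boundary≥2 (2F ∷ []) 2F 0F (outer List.++ inner) refl refl)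
          (boundary≥2 (0F ∷ 1F ∷ []) 0F 2F (outer List.++ inner) refl refl)
          (boundary≥2 (0F ∷ 2F ∷ []) 0F 1F (outer List.++ inner) refl refl))

    module _ (Q : Quotient Rung) where
      open Quotient Q

      rung-all : 2 + (share (count (0F , 1F)) + share (count (1F , 3F))) ≤ ⟪ move ⟫
      rung-all = subst (2 + (share (count (0F , 1F)) + share (count (1F , 3F))) ≤_)
        (sym (tally move rungEdges))
        (rung-total (count (0F , 1F)) (count (0F , 2F)) (count (1F , 2F))
                    (count (1F , 3F)) (count (2F , 3F))
          (boundary-even (1F ∷ []) rungEdges)
          (boundary≥2 (0F ∷ []) 0F 1F rungEdges refl refl)
          (boundary≥2 (3F ∷ []) 3F 1F rungEdges refl refl)
          (boundary≥2 (1F ∷ []) 1F 0F rungEdges refl refl)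
          (boundary≥2 (2F ∷ []) 2F 0F rungEdges refl refl)
          (boundary≥2 (0F ∷ 1F ∷ []) 0F 2F rungEdges refl refl)
          (boundary≥2 (0F ∷ 2F ∷ []) 0F 1F rungEdges refl refl))

  -- Splitting a ladder into quotients

  +-elim : ∀ {m n} (P : Fin (m + n) → Set) → (∀ a → P (a ↑ˡ n)) → (∀ y → P (m ↑ʳ y)) → ∀ u → P u
  +-elim {zero}  P l r u       = r u
  +-elim {suc m} P l r zero    = l zero
  +-elim {suc m} P l r (suc u) = +-elim (P ∘ suc) (l ∘ suc) r u

  onLeft : ∀ {m n k} → (Fin m → Fin k) → Fin k → Fin (m + n) → Fin k
  onLeft {m} f z = [ f , const z ]′ ∘ splitAt m

  onRight : ∀ {m n} → Fin (m + n) → Fin (1 + n)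
  onRight {m} = [ const zero , suc ]′ ∘ splitAt m

  -- In the vertex numbering of rooted (join block 6F 7F Y), the root is 0F and
  -- the vertex a of the block is 1 + a.
  toDiamond : Fin 9 → Fin 5
  toDiamond 3F = 1F
  toDiamond 4F = 2F
  toDiamond 5F = 3F
  toDiamond 6F = 4F
  toDiamond _  = 0F

  toRung : Fin 9 → Fin 4
  toRung 7F = 1F
  toRung 8F = 2F
  toRung _  = 0F

  module Layer {n} (Y : Adjacency n) where
    B : Adjacency (9 + n)
    B = rooted (join block 6F 7F Y)

    d : Fin (9 + n) → Fin 5
    d = onLeft toDiamond 0F

    r : Fin (9 + n) → Fin 4
    r = onLeft toRung 3F

    c : Fin (9 + n) → Fin (1 + n)
    c = onRight {9}

    -- `interior-eq` assigns each edge off the root to exactly one of the three quotients. `cut-eq`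
    -- lists the three edges at the first terminal: the entry, the attaching edge of the diamond and
    -- a rail. `entry-eq` identifies a right rail of the plain rung with the entry of the remaining
    -- ladder.
    record Splits (u v : Fin (9 + n)) : Set where
      constructor splits
      field
        d-hom : lax Diamond (d u) (d v) ≡ true
        r-hom : lax Rung (r u) (r v) ≡ true
        c-hom : lax (rooted Y) (c u) (c v) ≡ true
        interior-eq : interior u v ≡ move (d u) (d v) + (move (r u) (r v) + interior (c u) (c v))
        cut-eq : cut (among (1F ∷ [])) u v ≡
                 entry u v + (entry (d u) (d v) + edge (0F , 1F) (r u) (r v))
        entry-eq : edge (1F , 3F) (r u) (r v) ≡ entry (c u) (c v)

    splits? : ∀ u v → Dec (Splits u v)
    splits? u v = map′
      (λ (a , b , c , d , e , f) → splits a b c d e f)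
      (λ (splits a b c d e f) → a , b , c , d , e , f)
      ((_ Bool.≟ _) ×-dec (_ Bool.≟ _) ×-dec (_ Bool.≟ _) ×-dec
       (_ ℕ.≟ _) ×-dec (_ ℕ.≟ _) ×-dec (_ ℕ.≟ _))

    Lawful : Fin (9 + n) → Fin (9 + n) → Set
    Lawful u v = lax B u v ≡ true → Splits u v

    lawful? : ∀ u v → Dec (Lawful u v)
    lawful? u v = (lax B u v Bool.≟ true) →-dec splits? u v

  module _ where
    open Layer

    lawful-left : ∀ {n} (Y : Adjacency n) a b → Lawful Y (a ↑ˡ n) (b ↑ˡ n)
    lawful-left {n} Y = toWitness
      {a? = Fin.all? λ a → Fin.all? λ b → lawful? Y (a ↑ˡ n) (b ↑ˡ n)} _

    -- Only the first two vertices of `Y` have neighbours in the block. With these split off,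
    -- everything evaluates although `Y` is a variable.
    lawful-mixed : ∀ {n} (Y : Adjacency n) a y →
      Lawful Y (a ↑ˡ n) (9 ↑ʳ y) × Lawful Y (9 ↑ʳ y) (a ↑ˡ n)
    lawful-mixed {n} Y a zero = toWitness
      {a? = Fin.all? λ a → lawful? Y (a ↑ˡ n) 9F ×-dec lawful? Y 9F (a ↑ˡ n)} _ a
    lawful-mixed {n} Y a (suc zero) = toWitness
      {a? = Fin.all? λ a → lawful? Y (a ↑ˡ n) (suc 9F) ×-dec lawful? Y (suc 9F) (a ↑ˡ n)} _ a
    lawful-mixed {n} Y a y@(suc (suc _)) = toWitness
      {a? = Fin.all? λ a → lawful? Y (a ↑ˡ n) (9 ↑ʳ y) ×-dec lawful? Y (9 ↑ʳ y) (a ↑ˡ n)} _ a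

    lawful : ∀ {n} (Y : Adjacency n) u v → Lawful Y u v
    lawful Y = +-elim {9} (λ u → ∀ v → Lawful Y u v)
      (λ a → +-elim {9} (Lawful Y _) (lawful-left Y a) (λ y → proj₁ (lawful-mixed Y a y)))
      (λ x → +-elim {9} (Lawful Y _) (λ b → proj₂ (lawful-mixed Y b x))
        -- Between vertices of `Y`, `d` and `r` are constant and `c` loses nothing, so the
        -- hypothesis itself is the law for `c`.
        (λ y e → splits refl refl e refl refl refl))

  module Cap {n} (Y : Adjacency n) where
    B : Adjacency (4 + n)
    B = join diamond 0F 1F Y

    d : Fin (4 + n) → Fin 5
    d = onLeft suc 0F

    c : Fin (4 + n) → Fin (1 + n)
    c = onRight {4}

    record Splits (u v : Fin (4 + n)) : Set where
      constructor splits
      field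
        d-hom    : lax Diamond (d u) (d v) ≡ true
        c-hom    : lax (rooted Y) (c u) (c v) ≡ true
        move-eq  : move u v ≡ move (d u) (d v) + interior (c u) (c v)
        entry-eq : entry (d u) (d v) ≡ entry (c u) (c v)

    splits? : ∀ u v → Dec (Splits u v)
    splits? u v = map′
      (λ (a , b , c , d) → splits a b c d)
      (λ (splits a b c d) → a , b , c , d)
      ((_ Bool.≟ _) ×-dec (_ Bool.≟ _) ×-dec (_ ℕ.≟ _) ×-dec (_ ℕ.≟ _))

    Lawful : Fin (4 + n) → Fin (4 + n) → Set
    Lawful u v = lax B u v ≡ true → Splits u v

    lawful? : ∀ u v → Dec (Lawful u v)
    lawful? u v = (lax B u v Bool.≟ true) →-dec splits? u v

  module _ where
    open Cap

    cap-left : ∀ {n} (Y : Adjacency n) a b → Lawful Y (a ↑ˡ n) (b ↑ˡ n)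
    cap-left {n} Y = toWitness
      {a? = Fin.all? λ a → Fin.all? λ b → lawful? Y (a ↑ˡ n) (b ↑ˡ n)} _

    cap-mixed : ∀ {n} (Y : Adjacency n) a y →
      Lawful Y (a ↑ˡ n) (4 ↑ʳ y) × Lawful Y (4 ↑ʳ y) (a ↑ˡ n)
    cap-mixed {n} Y a zero = toWitness
      {a? = Fin.all? λ a → lawful? Y (a ↑ˡ n) 4F ×-dec lawful? Y 4F (a ↑ˡ n)} _ a
    cap-mixed {n} Y a (suc zero) = toWitness
      {a? = Fin.all? λ a → lawful? Y (a ↑ˡ n) 5F ×-dec lawful? Y 5F (a ↑ˡ n)} _ a
    cap-mixed {n} Y a y@(suc (suc _)) = toWitness
      {a? = Fin.all? λ a → lawful? Y (a ↑ˡ n) (4 ↑ʳ y) ×-dec lawful? Y (4 ↑ʳ y) (a ↑ˡ n)} _ a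

    cap-lawful : ∀ {n} (Y : Adjacency n) u v → Lawful Y u v
    cap-lawful Y = +-elim {4} (λ u → ∀ v → Lawful Y u v)
      (λ a → +-elim {4} (Lawful Y _) (cap-left Y a) (λ y → proj₁ (cap-mixed Y a y)))
      (λ x → +-elim {4} (Lawful Y _) (λ b → proj₂ (cap-mixed Y b x))
        (λ y e → splits refl e refl refl))

  -- The lower bound

  -- The vertices other than the terminals 0 and 1.
  size⁻ : ℕ → ℕ
  size⁻ zero    = 2
  size⁻ (suc i) = 8 + size⁻ i

  size : ℕ → ℕ
  size i = 2 + size⁻ i

  ladder : ∀ i → Adjacency (size i)
  ladder zero    = diamond
  ladder (suc i) = join block 6F 7F (ladder i)

  capped : ∀ i → Adjacency (4 + size i)
  capped i = join diamond 0F 1F (ladder i)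

  module Bound (Γ : Graph) {s} (p : Graph.Walk Γ s s) (spanning : Graph.Spanning Γ p) where
    open Tour Γ p spanning
    open Pieces Γ p spanning
    open Quotient

    compose : ∀ {m n} {B : Adjacency m} {C : Adjacency n} → Quotient B → (h : Fin m → Fin n) →
      (∀ u v → lax B u v ≡ true → lax C (h u) (h v) ≡ true) → (∀ a → ∃ λ u → h u ≡ a) → Quotient C
    compose Q h h-hom h-onto .map = h ∘ map Q
    compose Q h h-hom h-onto .hom u v e = h-hom _ _ (hom Q u v e)
    compose Q h h-hom h-onto .onto a with h-onto a
    ... | u , refl with onto Q u
    ...   | x , refl = x , refl

    -- The share of the entry edge is borrowed here and repaid by the part to the left. The last
    -- diamond gives 3 + 1. Each further layer adds the diamond bound, the rung bound and the parity
    -- bound at the first terminal, which together are worth 10 once the shares cancel.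
    ladder-bound : ∀ i (Q : Quotient (rooted (ladder i))) →
      4 + i * 10 ≤ ⟪_⟫ Q interior + share (⟪_⟫ Q entry)
    ladder-bound zero    Q = ℕ.+-mono-≤ (diamond-inner Q) (1≤share (⟪_⟫ Q entry))
    ladder-bound (suc i) Q = subst (λ k → 4 + suc i * 10 ≤ k + share x) (sym interior-sum)
      -- `g` and `z` are repaid by the diamond and the rung of this layer, and `x′`, borrowed by the
      -- induction hypothesis, by the rung.
      (ℕ.+-cancelʳ-≤ (share g + share z + share x′) _ _ (subst₂ _≤_
        (regroupˡ (share g) (share z) (share x′) (i * 10))
        (regroupʳ (⟪_⟫ D move) (⟪_⟫ R move) (⟪_⟫ C interior)
                  (share x) (share g) (share z) (share x′))
        (ℕ.+-mono-≤ (ℕ.+-mono-≤ (diamond-all D) (rung-all R))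
          (ℕ.+-mono-≤ rest (share-sum x g z even)))))
      where
      open Layer (ladder i) using (d; r; c; Splits)
      open Splits
      laws : ∀ u v → lax (rooted (ladder (suc i))) u v ≡ true → Splits u v
      laws = lawful (ladder i)

      D : Quotient Diamond
      D = compose Q d (λ u v e → d-hom (laws u v e)) λ
        { 0F → 0F , refl ; 1F → 3F , refl ; 2F → 4F , refl ; 3F → 5F , refl ; 4F → 6F , refl }

      R : Quotient Rung
      R = compose Q r (λ u v e → r-hom (laws u v e)) λ
        { 0F → 0F , refl ; 1F → 7F , refl ; 2F → 8F , refl ; 3F → 9F , refl }

      C : Quotient (rooted (ladder i))
      C = compose Q c (λ u v e → c-hom (laws u v e)) λ
        { zero → 0F , refl ; (suc y) → 9 ↑ʳ y , refl }

      x = ⟪_⟫ Q entry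
      g = ⟪_⟫ D entry
      z = count R (0F , 1F)
      x′ = count R (1F , 3F)

      interior-sum : ⟪_⟫ Q interior ≡ ⟪_⟫ D move + (⟪_⟫ R move + ⟪_⟫ C interior)
      interior-sum = trans (⟪⟫-cong Q (λ u v e → interior-eq (laws u v e)))
        (trans (⟪⟫-⊕ Q (move on d) ((move on r) ⊕ (interior on c)))
          (cong (⟪_⟫ D move +_) (⟪⟫-⊕ Q (move on r) (interior on c))))

      even : odd (x + (g + z)) ≡ false
      even = subst (λ k → odd k ≡ false)
        (trans (⟪⟫-cong Q (λ u v e → cut-eq (laws u v e)))
          (trans (⟪⟫-⊕ Q entry ((entry on d) ⊕ (edge (0F , 1F) on r)))
            (cong (x +_) (⟪⟫-⊕ Q (entry on d) (edge (0F , 1F) on r)))))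
        (even-cut (among (1F ∷ []) ∘ map Q))

      rest : 4 + i * 10 ≤ ⟪_⟫ C interior + share x′
      rest = subst (λ k → 4 + i * 10 ≤ ⟪_⟫ C interior + share k)
        (sym (⟪⟫-cong Q (λ u v e → entry-eq (laws u v e)))) (ladder-bound i C)

      regroupˡ : ∀ g z x k → 4 + g + (2 + (z + x)) + (4 + k + 4) ≡ 4 + (10 + k) + (g + z + x)
      regroupˡ = solve-∀

      regroupʳ : ∀ a b c x g z y →
        a + b + (c + y + (x + (g + z))) ≡ a + (b + c) + x + (g + z + y)
      regroupʳ = solve-∀

    -- The diamond of the cap yields `share g` above 4, which repays the share borrowed by the
    -- ladder: both concern the same edge.
    capped-bound : ∀ i (Q : Quotient (capped i)) → 8 + i * 10 ≤ ⟪_⟫ Q move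
    capped-bound i Q = subst (8 + i * 10 ≤_) (sym move-sum)
      (ℕ.+-cancelʳ-≤ (share g) _ _ (subst₂ _≤_
        (regroupˡ (share g) (i * 10)) (regroupʳ (⟪_⟫ D move) (⟪_⟫ C interior) (share g))
        (ℕ.+-mono-≤ (diamond-all D) rest)))
      where
      open Cap (ladder i) using (d; c; Splits)
      open Splits
      laws : ∀ u v → lax (capped i) u v ≡ true → Splits u v
      laws = cap-lawful (ladder i)

      D : Quotient Diamond
      D = compose Q d (λ u v e → d-hom (laws u v e)) λ
        { zero → 4F , refl ; 1F → 0F , refl ; 2F → 1F , refl ; 3F → 2F , refl ; 4F → 3F , refl }

      C : Quotient (rooted (ladder i))
      C = compose Q c (λ u v e → c-hom (laws u v e)) λ
        { zero → 0F , refl ; (suc y) → 4 ↑ʳ y , refl }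

      g = ⟪_⟫ D entry

      move-sum : ⟪_⟫ Q move ≡ ⟪_⟫ D move + ⟪_⟫ C interior
      move-sum = trans (⟪⟫-cong Q (λ u v e → move-eq (laws u v e)))
        (⟪⟫-⊕ Q (move on d) (interior on c))

      rest : 4 + i * 10 ≤ ⟪_⟫ C interior + share g
      rest = subst (λ k → 4 + i * 10 ≤ ⟪_⟫ C interior + share k)
        (sym (⟪⟫-cong Q (λ u v e → entry-eq (laws u v e)))) (ladder-bound i C)

      regroupˡ : ∀ g k → 4 + g + (4 + k) ≡ 8 + k + g
      regroupˡ = solve-∀

      regroupʳ : ∀ a b g → a + (b + g) ≡ a + b + g
      regroupʳ = solve-∀

  -- The graphs G i

  Symmetric Irreflexive : ∀ {n} → Adjacency n → Set
  Symmetric   B = ∀ u v → B u v ≡ true → B v u ≡ true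
  Irreflexive B = ∀ v → B v v ≡ false

  adjacent⁺ : ∀ {n} (B : Adjacency n) u v → v ∈ Vec.tabulate (B u) → B u v ≡ true
  adjacent⁺ B u v e = trans (sym (Vec.lookup∘tabulate (B u) v)) (Vec.[]=⇒lookup e)

  adjacent⁻ : ∀ {n} (B : Adjacency n) u v → B u v ≡ true → v ∈ Vec.tabulate (B u)
  adjacent⁻ B u v e = Vec.lookup⇒[]= v _ (trans (Vec.lookup∘tabulate (B u) v) e)

  graph : ∀ {n} (B : Adjacency n) → Symmetric B → Irreflexive B → Graph
  graph {n} B sy ir = record
    { order       = n
    ; neighbours  = Vec.tabulate ∘ B
    ; symmetric   = λ {u} {v} e → adjacent⁻ B v u (sy u v (adjacent⁺ B u v e))
    ; irreflexive = λ v e → contradiction (trans (sym (adjacent⁺ B v v e)) (ir v)) λ ()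
    }

  symmetric? : ∀ {n} (B : Adjacency n) → Dec (Symmetric B)
  symmetric? B = Fin.all? λ u → Fin.all? λ v → (B u v Bool.≟ true) →-dec (B v u Bool.≟ true)

  irreflexive? : ∀ {n} (B : Adjacency n) → Dec (Irreflexive B)
  irreflexive? B = Fin.all? λ v → B v v Bool.≟ false

  module _ {m n} {P : Adjacency m} {Y : Adjacency n} (α β : Fin m) where
    join-symmetric : Symmetric P → Symmetric Y → Symmetric (join P α β Y)
    join-symmetric sP sY u v with splitAt m u | splitAt m v
    ... | inj₁ a | inj₁ b = sP a b
    ... | inj₁ a | inj₂ y = λ e → e
    ... | inj₂ x | inj₁ b = λ e → e
    ... | inj₂ x | inj₂ y = sY x y

    join-irreflexive : Irreflexive P → Irreflexive Y → Irreflexive (join P α β Y)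
    join-irreflexive iP iY v with splitAt m v
    ... | inj₁ a = iP a
    ... | inj₂ x = iY x

  ladder-symmetric : ∀ i → Symmetric (ladder i)
  ladder-symmetric zero    = toWitness {a? = symmetric? diamond} _
  ladder-symmetric (suc i) =
    join-symmetric 6F 7F (toWitness {a? = symmetric? block} _) (ladder-symmetric i)

  ladder-irreflexive : ∀ i → Irreflexive (ladder i)
  ladder-irreflexive zero    = toWitness {a? = irreflexive? diamond} _
  ladder-irreflexive (suc i) =
    join-irreflexive {Y = ladder i} 6F 7F (toWitness {a? = irreflexive? block} _)
      (ladder-irreflexive i)

  G : ℕ → Graph
  G i = graph (capped i)
    (join-symmetric 0F 1F (toWitness {a? = symmetric? diamond} _) (ladder-symmetric i))
    (join-irreflexive {Y = ladder i} 0F 1F (toWitness {a? = irreflexive? diamond} _)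
      (ladder-irreflexive i))

  deg : ∀ {n} → Adjacency n → Fin n → ℕ
  deg B v = ∣ Vec.tabulate (B v) ∣

  no-neighbours : ∀ n → ∣ Vec.tabulate {n = n} (λ _ → false) ∣ ≡ 0
  no-neighbours zero    = refl
  no-neighbours (suc n) = no-neighbours n

  ladder-degree : ∀ i → deg (ladder i) 0F ≡ 2 × deg (ladder i) 1F ≡ 2 ×
                        (∀ v → deg (ladder i) (suc (suc v)) ≡ 3)
  ladder-degree zero = refl , refl , λ { 0F → refl ; 1F → refl }
  ladder-degree (suc i) with ladder-degree i
  ... | d₀ , d₁ , d₂ = cong (2 +_) none , cong (2 +_) none , λ
    { 0F → cong (3 +_) none ; 1F → cong (3 +_) none ; 2F → cong (3 +_) none
    ; 3F → cong (3 +_) none ; 4F → cong (3 +_) none ; 5F → cong (3 +_) none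
    ; 6F → cong suc d₀ ; 7F → cong suc d₁
    ; (suc (suc (suc (suc (suc (suc (suc (suc v)))))))) → d₂ v }
    where
    none = no-neighbours (size⁻ i)

  cubic : ∀ i → Cubic (G i)
  cubic i with ladder-degree i
  ... | d₀ , d₁ , d₂ = λ
    { 0F → cong (3 +_) none ; 1F → cong (3 +_) none ; 2F → cong (3 +_) none
    ; 3F → cong (3 +_) none
    ; 4F → cong suc d₀ ; 5F → cong suc d₁
    ; (suc (suc (suc (suc (suc (suc v)))))) → d₂ v }
    where
    none = no-neighbours (size⁻ i)

  module _ (i : ℕ) where
    open Graph (G i) using (Walk; Adjacent; Spanning; length; irreflexive; symmetric)

    length-bound : ∀ {s t} (p : Walk s t) → Spanning p → Adjacent s t → 7 + i * 10 ≤ length p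
    length-bound {s} {t} p spanning st = ℕ.s≤s⁻¹ (subst (8 + i * 10 ≤_) moves (capped-bound i Q))
      where
      tour : Walk t t
      tour = symmetric st ◅ p
      open Tour (G i) tour (there ∘ spanning)
      open Bound (G i) tour (there ∘ spanning)

      Q : Quotient (capped i)
      Q = record
        { map  = λ u → u
        ; hom  = λ u v e → trans (cong (u == v ∨_) (adjacent⁺ (capped i) u v e)) (Bool.∨-zeroʳ _)
        ; onto = λ u → u , refl
        }

      move≡1 : ∀ u v → Adjacent u v → move u v ≡ 1
      move≡1 u v e with u Fin.≟ v
      ... | yes refl = contradiction e (irreflexive u)
      ... | no  _    = refl

      moves : ⟦ move ⟧ ≡ suc (length p)
      moves = trans (weight-cong (G i) move≡1 tour) (weight-one (G i) tour)

  -- 2-connectivity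

  singleton : ∀ {n} (X : Subset n) → ∣ X ∣ < 2 → ∀ {x} → x ∈ X → ∀ {y} → y ∈ X → y ≡ x
  singleton X X<2 {x} x∈X {y} y∈X with y Fin.≟ x
  ... | yes y≡x = y≡x
  ... | no  y≢x = contradiction
    (ℕ.≤-trans (s≤s (ℕ.≤-trans (s≤s z≤n) (Subset.x∈p⇒∣p-x∣<∣p∣ (Subset.x∈p∧x≢y⇒x∈p-y y∈X y≢x))))
      (Subset.x∈p⇒∣p-x∣<∣p∣ x∈X))
    (ℕ.<⇒≱ X<2)

  -- After deleting x, descend to a from the vertices of rank at most that of x and
  -- ascend to b from the others; neither path meets x again, and a and b are adjacent.
  module Bipolar (Γ : Graph) where
    open Graph Γ using (Adjacent; Walk; vertices; symmetric)

    Descending Ascending : (Vertex Γ → ℕ) → Vertex Γ → Set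
    Descending r c = ∀ v → v ≡ c ⊎ ∃ λ w → Adjacent v w × r w < r v
    Ascending  r c = ∀ v → v ≡ c ⊎ ∃ λ w → Adjacent v w × r v < r w

    module _ (rank : Vertex Γ → ℕ) (top : ℕ) (rank≤top : ∀ v → rank v ≤ top)
      {a b : Vertex Γ} (ab : Adjacent a b)
      (lower : Descending rank a) (upper : Ascending rank b) where

      module _ (X : Subset (order Γ)) where
        Link : Vertex Γ → Vertex Γ → Set
        Link u v = Adjacent u v × u ∉ X × v ∉ X

        Link-sym : ∀ {u v} → Link u v → Link v u
        Link-sym (e , u∉X , v∉X) = symmetric e , v∉X , u∉X

        last∉ : ∀ {u v} → u ∉ X → Star Link u v → v ∉ X
        last∉ u∉X ε                  = u∉X
        last∉ _   ((_ , _ , v∉X) ◅ p) = last∉ v∉X p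

        toWalk : ∀ {u v} → u ∉ X → Star Link u v → ∃ λ (p : Walk u v) → All (_∉ X) (vertices p)
        toWalk u∉X ε = ε , u∉X ∷ []
        toWalk u∉X ((e , _ , v∉X) ◅ p) with toWalk v∉X p
        ... | q , avoids = e ◅ q , u∉X ∷ avoids

        module _ (x : Vertex Γ) (X⊆x : ∀ {y} → y ∈ X → y ≡ x) where
          descend : ∀ r {c} → Descending r c → ∀ v → v ∉ X → r v ≤ r x → Star Link v c
          descend r {c} down v v∉X v≤x = go v v∉X v≤x (ℕ.<-wellFounded (r v))
            where
            go : ∀ v → v ∉ X → r v ≤ r x → Acc _<_ (r v) → Star Link v c
            go v v∉X v≤x (acc rec) with down v
            ... | inj₁ refl = ε
            ... | inj₂ (w , e , w<v) = (e , v∉X , w∉X) ◅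
                  go w w∉X (ℕ.≤-trans (ℕ.<⇒≤ w<v) v≤x) (rec w<v)
              where
              w∉X : w ∉ X
              w∉X w∈X = ℕ.<⇒≱ (ℕ.<-≤-trans w<v v≤x) (ℕ.≤-reflexive (cong r (sym (X⊆x w∈X))))

          ends : ∀ v → v ∉ X → Star Link v a ⊎ Star Link v b
          ends v v∉X with ℕ.≤-total (rank v) (rank x)
          ... | inj₁ v≤x = inj₁ (descend rank lower v v∉X v≤x)
          -- Subtracting ranks from `top` turns the ascent into a descent.
          ... | inj₂ x≤v = inj₂ (descend (λ u → top ∸ rank u) upper′ v v∉X (ℕ.∸-monoʳ-≤ top x≤v))
            where
            upper′ : Descending (λ u → top ∸ rank u) b
            upper′ v with upper v
            ... | inj₁ v≡b           = inj₁ v≡b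
            ... | inj₂ (w , e , v<w) = inj₂ (w , e , ℕ.∸-monoʳ-< v<w (rank≤top w))

          connect : ∀ u v → u ∉ X → v ∉ X → Star Link u v
          connect u v u∉X v∉X with ends u u∉X | ends v v∉X
          ... | inj₁ p | inj₁ q = p ◅◅ Star.reverse Link-sym q
          ... | inj₂ p | inj₂ q = p ◅◅ Star.reverse Link-sym q
          ... | inj₁ p | inj₂ q =
            p ◅◅ (ab , last∉ u∉X p , last∉ v∉X q) ◅ Star.reverse Link-sym q
          ... | inj₂ p | inj₁ q =
            p ◅◅ (symmetric ab , last∉ u∉X p , last∉ v∉X q) ◅ Star.reverse Link-sym q

      biconnected : 2 < order Γ → VertexConnected 2 Γ
      biconnected large = large , connected
        where
        connected : ∀ X → ∣ X ∣ < 2 → ∀ u v → u ∉ X → v ∉ X →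
                    ∃ λ (p : Walk u v) → All (_∉ X) (vertices p)
        connected X X<2 u v u∉X v∉X with Subset.nonempty? X
        ... | yes (x , x∈X) =
          toWalk X u∉X (connect X x (singleton X X<2 x∈X) u v u∉X v∉X)
        ... | no empty =
          -- With nothing deleted, any vertex can serve as the reference for ranks.
          toWalk X u∉X (connect X u (λ y∈X → contradiction (_ , y∈X) empty) u v u∉X v∉X)

  height : ℕ → ℕ
  height zero    = 2
  height (suc i) = 4 + height i

  -- Ranks increase along the rail of 0F away from it and back along the rail of 1F.
  rank : ∀ i → Fin (size i) → ℕ
  rank zero 0F = 0
  rank zero 1F = 2
  rank zero _  = 1
  rank (suc i) 0F = 0
  rank (suc i) 1F = 4 + height i
  rank (suc i) 2F = 1
  rank (suc i) 3F = 3
  rank (suc i) 4F = 2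
  rank (suc i) 5F = 2
  rank (suc i) 6F = 1
  rank (suc i) 7F = 3 + height i
  rank (suc i) (suc (suc (suc (suc (suc (suc (suc (suc y)))))))) = 2 + rank i y

  rank-1 : ∀ i → rank i 1F ≡ height i
  rank-1 zero    = refl
  rank-1 (suc i) = refl

  rank≤height : ∀ i y → rank i y ≤ height i
  rank≤height zero 0F = z≤n
  rank≤height zero 1F = ℕ.≤-refl
  rank≤height zero 2F = s≤s z≤n
  rank≤height zero 3F = s≤s z≤n
  rank≤height (suc i) 0F = z≤n
  rank≤height (suc i) 1F = ℕ.≤-refl
  rank≤height (suc i) 2F = ℕ.m≤m+n 1 _
  rank≤height (suc i) 3F = ℕ.m≤m+n 3 _
  rank≤height (suc i) 4F = ℕ.m≤m+n 2 _
  rank≤height (suc i) 5F = ℕ.m≤m+n 2 _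
  rank≤height (suc i) 6F = ℕ.m≤m+n 1 _
  rank≤height (suc i) 7F = ℕ.n≤1+n _
  rank≤height (suc i) (suc (suc (suc (suc (suc (suc (suc (suc y)))))))) =
    s≤s (s≤s (ℕ.≤-trans (rank≤height i y) (ℕ.m≤n+m _ 2)))

  lower : ∀ i v → v ≡ 0F ⊎ ∃ λ w → ladder i v w ≡ true × rank i w < rank i v
  lower zero 0F = inj₁ refl
  lower zero 1F = inj₂ (2F , refl , ℕ.≤-refl)
  lower zero 2F = inj₂ (0F , refl , ℕ.≤-refl)
  lower zero 3F = inj₂ (0F , refl , ℕ.≤-refl)
  lower (suc i) 0F = inj₁ refl
  lower (suc i) 1F = inj₂ (3F , refl , ℕ.m≤m+n 4 _)
  lower (suc i) 2F = inj₂ (0F , refl , ℕ.≤-refl)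
  lower (suc i) 3F = inj₂ (4F , refl , ℕ.≤-refl)
  lower (suc i) 4F = inj₂ (2F , refl , ℕ.≤-refl)
  lower (suc i) 5F = inj₂ (2F , refl , ℕ.≤-refl)
  lower (suc i) 6F = inj₂ (0F , refl , ℕ.≤-refl)
  lower (suc i) 7F = inj₂ (9F , refl , ℕ.≤-reflexive (cong (3 +_) (rank-1 i)))
  lower (suc i) (suc (suc (suc (suc (suc (suc (suc (suc y)))))))) with lower i y
  ... | inj₁ refl          = inj₂ (6F , refl , s≤s (s≤s z≤n))
  ... | inj₂ (w , e , w<y) = inj₂ (8 ↑ʳ w , e , s≤s (s≤s w<y))

  upper : ∀ i v → v ≡ 1F ⊎ ∃ λ w → ladder i v w ≡ true × rank i v < rank i w
  upper zero 0F = inj₂ (2F , refl , ℕ.≤-refl)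
  upper zero 1F = inj₁ refl
  upper zero 2F = inj₂ (1F , refl , ℕ.≤-refl)
  upper zero 3F = inj₂ (1F , refl , ℕ.≤-refl)
  upper (suc i) 0F = inj₂ (2F , refl , ℕ.≤-refl)
  upper (suc i) 1F = inj₁ refl
  upper (suc i) 2F = inj₂ (4F , refl , ℕ.≤-refl)
  upper (suc i) 3F = inj₂ (1F , refl , ℕ.m≤m+n 4 _)
  upper (suc i) 4F = inj₂ (3F , refl , ℕ.≤-refl)
  upper (suc i) 5F = inj₂ (3F , refl , ℕ.≤-refl)
  upper (suc i) 6F = inj₂ (8F , refl , s≤s (s≤s z≤n))
  upper (suc i) 7F = inj₂ (1F , refl , ℕ.≤-refl)
  upper (suc i) (suc (suc (suc (suc (suc (suc (suc (suc y)))))))) with upper i y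
  ... | inj₁ refl          = inj₂ (7F , refl , ℕ.≤-reflexive (cong (3 +_) (rank-1 i)))
  ... | inj₂ (w , e , y<w) = inj₂ (8 ↑ʳ w , e , s≤s (s≤s y<w))

  module _ (i : ℕ) where
    -- The poles are the two adjacent middle vertices of the cap; the ranks of the ladder, shifted
    -- by 2, lie between those of the cap.
    cappedRank : Vertex (G i) → ℕ
    cappedRank 0F = 1
    cappedRank 1F = 3 + height i
    cappedRank 2F = 0
    cappedRank 3F = 4 + height i
    cappedRank (suc (suc (suc (suc y)))) = 2 + rank i y

    cappedRank≤ : ∀ v → cappedRank v ≤ 4 + height i
    cappedRank≤ 0F = ℕ.m≤m+n 1 _
    cappedRank≤ 1F = ℕ.n≤1+n _
    cappedRank≤ 2F = z≤n
    cappedRank≤ 3F = ℕ.≤-refl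
    cappedRank≤ (suc (suc (suc (suc y)))) =
      s≤s (s≤s (ℕ.≤-trans (rank≤height i y) (ℕ.m≤n+m _ 2)))

    cappedLower : ∀ v → v ≡ 2F ⊎ ∃ λ w → capped i v w ≡ true × cappedRank w < cappedRank v
    cappedLower 0F = inj₂ (2F , refl , ℕ.≤-refl)
    cappedLower 1F = inj₂ (2F , refl , s≤s z≤n)
    cappedLower 2F = inj₁ refl
    cappedLower 3F = inj₂ (1F , refl , ℕ.≤-refl)
    cappedLower (suc (suc (suc (suc y)))) with lower i y
    ... | inj₁ refl          = inj₂ (0F , refl , s≤s (s≤s z≤n))
    ... | inj₂ (w , e , w<y) = inj₂ (4 ↑ʳ w , e , s≤s (s≤s w<y))

    cappedUpper : ∀ v → v ≡ 3F ⊎ ∃ λ w → capped i v w ≡ true × cappedRank v < cappedRank w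
    cappedUpper 0F = inj₂ (4F , refl , s≤s (s≤s z≤n))
    cappedUpper 1F = inj₂ (3F , refl , ℕ.≤-refl)
    cappedUpper 2F = inj₂ (0F , refl , ℕ.≤-refl)
    cappedUpper 3F = inj₁ refl
    cappedUpper (suc (suc (suc (suc y)))) with upper i y
    ... | inj₁ refl          = inj₂ (1F , refl , ℕ.≤-reflexive (cong (3 +_) (rank-1 i)))
    ... | inj₂ (w , e , y<w) = inj₂ (4 ↑ʳ w , e , s≤s (s≤s y<w))

    biconnected : VertexConnected 2 (G i)
    biconnected = Bipolar.biconnected (G i) cappedRank (4 + height i) cappedRank≤
      (adjacent⁻ (capped i) 2F 3F refl)
      (λ v → Sum.map₂ (λ (w , e , w<v) → w , adjacent⁻ (capped i) v w e , w<v) (cappedLower v))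
      (λ v → Sum.map₂ (λ (w , e , v<w) → w , adjacent⁻ (capped i) v w e , v<w) (cappedUpper v))
      (s≤s (s≤s (s≤s z≤n)))

  -- Existence of OPT

  least : ∀ {P : ℕ → Set} → (∀ n → Dec (P n)) → ∀ n → P n → ∃ λ k → P k × (∀ m → P m → k ≤ m)
  least P? n Pn with P? 0
  ... | yes P0 = 0 , P0 , λ _ _ → z≤n
  least P? zero    P0 | no ¬P0 = contradiction P0 ¬P0
  least {P} P? (suc n) Pn | no ¬P0 with least (P? ∘ suc) n Pn
  ... | k , Pk , min = suc k , Pk , λ
    { zero    P0 → contradiction P0 ¬P0
    ; (suc m) Pm → s≤s (min m Pm) }

  module Search (Γ : Graph) where
    open Graph Γ using (Walk; vertices; length; neighbours)

    WalkWith : ℕ → Vertex Γ → Vertex Γ → (List (Vertex Γ) → Set) → Set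
    WalkWith k u t Q = ∃ λ (p : Walk u t) → Q (vertices p) × length p ≡ k

    -- The property of the vertex list is arbitrary so that the recursion can absorb the first
    -- vertex into it.
    walk? : ∀ k u t {Q : List (Vertex Γ) → Set} → (∀ xs → Dec (Q xs)) → Dec (WalkWith k u t Q)
    walk? zero u t Q? with u Fin.≟ t
    ... | no u≢t = no λ { (ε , _) → u≢t refl }
    ... | yes refl = map′ (λ q → ε , q , refl) (λ { (ε , q , _) → q }) (Q? (u ∷ []))
    walk? (suc k) u t Q? = map′
      (λ { (v , e , p , q , refl) → e ◅ p , q , refl })
      (λ { (e ◅ p , q , refl) → _ , e , p , q , refl })
      (Fin.any? λ v → (v Subset.∈? neighbours u) ×-dec walk? k v t (Q? ∘ (u ∷_)))

    first∈ : ∀ {u t} (p : Walk u t) → u ∈ˡ vertices p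
    first∈ ε       = here refl
    first∈ (_ ◅ _) = here refl

    suffix∈ : ∀ {u v t} (p : Walk u v) (q : Walk v t) {x} → x ∈ˡ vertices q → x ∈ˡ vertices (p ◅◅ q)
    suffix∈ ε       q x∈q = x∈q
    suffix∈ (_ ◅ p) q x∈q = there (suffix∈ p q x∈q)

    module _ (path : ∀ u v → Walk u v) where
      visitAll : ∀ xs u t → ∃ λ (p : Walk u t) → ∀ {x} → x ∈ˡ xs → x ∈ˡ vertices p
      visitAll []       u t = path u t , λ ()
      visitAll (x ∷ xs) u t with visitAll xs x t
      ... | p , visits = path u x ◅◅ p , λ
        { (here refl) → suffix∈ (path u x) p (first∈ p)
        ; (there y∈xs) → suffix∈ (path u x) p (visits y∈xs) }

      -- Concatenated paths give some spanning walk; its length bounds the search for the least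
      -- length, which is decidable.
      opt : ∀ s t → ∃ (IsOPT Γ s t)
      opt s t with visitAll (List.allFin _) s t
      ... | p , visits with least (λ k → walk? k s t λ xs → Fin.all? (_∈? xs))
                                  (length p) (p , (λ x → visits (∈-allFin x)) , refl)
        where open Membership Fin._≟_ using (_∈?_)
      ... | k , shortest , minimal = k , shortest , λ q spanning → minimal _ (q , spanning , refl)

  order-G : ∀ i → order (G i) ≡ i * 8 + 8
  order-G zero    = refl
  order-G (suc i) = cong (8 +_) (order-G i)

  module _ (i : ℕ) where
    open Graph (G i) using (Walk; Adjacent)

    -- An edge of the cap, so that adjacency evaluates for every `i`.
    source target : Vertex (G i)
    source = 0F
    target = 2F

    source~target : Adjacent source target
    source~target = adjacent⁻ (capped i) source target refl

    shortest : ∃ (IsOPT (G i) source target)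
    shortest = Search.opt (G i) path source target
      where
      path : ∀ u v → Walk u v
      path u v = proj₁ (proj₂ (biconnected i) ⊥ small u v Subset.∉⊥ Subset.∉⊥)
        where
        small : ∣ ⊥ {order (G i)} ∣ < 2
        small = subst (_< 2) (sym (Subset.∣⊥∣≡0 (order (G i)))) (s≤s z≤n)

    opt≥ : ∀ {k} → IsOPT (G i) source target k → 7 + i * 10 ≤ k
    opt≥ ((p , spanning , refl) , _) = length-bound i p spanning source~target

  non-isomorphic : ∀ i j → i ≢ j → ¬ (G i ≅ G j)
  non-isomorphic i j i≢j (f , _) = i≢j (ℕ.*-cancelʳ-≡ i j 8 (ℕ.+-cancelʳ-≡ 8 _ _
    (trans (sym (order-G i)) (trans (↔⇒≡ f) (order-G j)))))

-- Rational arithmetic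

open import Data.Integer.Base as ℤ using (+_; -[1+_])
open import Data.Rational.Base as ℚ using (ℚ; mkℚ; 0ℚ; 1ℚ; _+_; _/_; _*_; _-_; _≤_; _<_)

p≤∣p∣ : ∀ p → p ≤ ℚ.∣ p ∣
p≤∣p∣ p@(mkℚ (+ _) _ _)    = ℚ.≤-refl
p≤∣p∣ p@(mkℚ -[1+ _ ] _ _) = ℚ.≤-trans (ℚ.nonPositive⁻¹ p) (ℚ.0≤∣p∣ p)

integral : ∀ n → fromℕ n ≡ mkℚ (+ n) 0 (Coprime.sym (Coprime.1-coprimeTo n))
integral n = ℚ.normalize-coprime (Coprime.sym (Coprime.1-coprimeTo n))

fromℕ-+ : ∀ m n → fromℕ (m ℕ.+ n) ≡ fromℕ m + fromℕ n
fromℕ-+ m n rewrite integral m | integral n =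
  cong (_/ 1) (sym (cong₂ ℤ._+_ (ℤ.*-identityʳ (+ m)) (ℤ.*-identityʳ (+ n))))

fromℕ-* : ∀ m n → fromℕ (m ℕ.* n) ≡ fromℕ m * fromℕ n
fromℕ-* m n rewrite integral m | integral n = cong (_/ 1) (ℤ.pos-* m n)

fromℕ-mono-≤ : ∀ {m n} → m ℕ.≤ n → fromℕ m ≤ fromℕ n
fromℕ-mono-≤ {m} {n} m≤n rewrite integral m | integral n =
  ℚ.*≤* (ℤ.*-monoʳ-≤-nonNeg (+ 1) (ℤ.+≤+ m≤n))

archimedean : ∀ r δ → 0ℚ < δ → ∃ λ n → r < fromℕ n * δ
-- `n` is the absolute numerator of `r` divided by `δ`, an upper bound since denominators are at
-- least 1; the successor makes the inequality strict.
archimedean r δ 0<δ = suc n , (begin-strict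
  r                      ≡⟨ ℚ.*-identityʳ r ⟨
  r * 1ℚ                 ≡⟨ cong (r *_) (ℚ.*-inverseˡ δ) ⟨
  r * (ℚ.1/ δ * δ)       ≡⟨ ℚ.*-assoc r (ℚ.1/ δ) δ ⟨
  q * δ                  ≤⟨ ℚ.*-monoʳ-≤-nonNeg δ (≤numerator q) ⟩
  fromℕ n * δ            <⟨ ℚ.*-monoˡ-<-pos δ n<1+n ⟩
  fromℕ (suc n) * δ      ∎)
  where
  open ℚ.≤-Reasoning
  instance
    δ-positive : ℚ.Positive δ
    δ-positive = ℚ.positive 0<δ
    δ-nonNegative : ℚ.NonNegative δ
    δ-nonNegative = ℚ.pos⇒nonNeg δ
    δ-nonZero : ℚ.NonZero δ
    δ-nonZero = ℚ.pos⇒nonZero δ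
  q = r * ℚ.1/ δ
  n = ℤ.∣ ℚ.↥ q ∣
  ≤numerator : ∀ p → p ≤ fromℕ ℤ.∣ ℚ.↥ p ∣
  ≤numerator p@(mkℚ (+ n) d _) rewrite integral n = ℚ.*≤*
    (ℤ.*-monoˡ-≤-nonNeg (+ n) (ℤ.+≤+ (s≤s z≤n)))
  ≤numerator p@(mkℚ -[1+ n ] _ _) =
    ℚ.≤-trans (ℚ.nonPositive⁻¹ p) (fromℕ-mono-≤ {0} {suc n} z≤n)
  n<1+n : fromℕ n < fromℕ (suc n)
  n<1+n = subst₂ _<_ (ℚ.+-identityˡ (fromℕ n)) (sym (fromℕ-+ 1 n))
    (ℚ.+-monoˡ-< (fromℕ n) {0ℚ} {1ℚ} (ℚ.*<* (ℤ.+<+ (s≤s z≤n))))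

seq-· : ∀ n α m → seq (n · α) m ≡ fromℕ n * seq α m
seq-· zero    α m = sym (ℚ.*-zeroˡ (seq α m))
seq-· (suc n) α m = begin
  seq α m + seq (n · α) m                ≡⟨ cong₂ _+_ (sym (ℚ.*-identityˡ (seq α m))) (seq-· n α m) ⟩
  1ℚ * seq α m + fromℕ n * seq α m       ≡⟨ ℚ.*-distribʳ-+ (seq α m) 1ℚ (fromℕ n) ⟨
  (1ℚ + fromℕ n) * seq α m               ≡⟨ cong (_* seq α m) (fromℕ-+ 1 n) ⟨
  fromℕ (suc n) * seq α m                ∎
  where open ≡-Reasoning

-- From the lower bound to the asymptotic statement

5/4 3ℚ : ℚ
5/4 = + 5 / 4
3ℚ  = + 3 / 1

-- With 8i + 8 vertices, 5/4 of the order is 10i + 10, which exceeds the bound 10i + 7 by 3.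
opt-bound : ∀ i {k} → IsOPT (G i) (source i) (target i) k →
            5/4 * fromℕ (order (G i)) - 3ℚ ≤ fromℕ k
opt-bound i {k} isOPT = begin
  5/4 * fromℕ (order (G i)) - 3ℚ           ≡⟨ cong (λ n → 5/4 * fromℕ n - 3ℚ) (order-G i) ⟩
  5/4 * fromℕ (i ℕ.* 8 ℕ.+ 8) - 3ℚ         ≡⟨ cong (λ q → 5/4 * q - 3ℚ) order-ℚ ⟩
  5/4 * (fromℕ i * fromℕ 8 + fromℕ 8) - 3ℚ ≡⟨ evaluate (fromℕ i) ⟩
  fromℕ 7 + fromℕ i * fromℕ 10             ≡⟨ cong (λ q → fromℕ 7 + q) (fromℕ-* i 10) ⟨
  fromℕ 7 + fromℕ (i ℕ.* 10)               ≡⟨ fromℕ-+ 7 (i ℕ.* 10) ⟨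
  fromℕ (7 ℕ.+ i ℕ.* 10)                   ≤⟨ fromℕ-mono-≤ (opt≥ i isOPT) ⟩
  fromℕ k                                  ∎
  where
  open ℚ.≤-Reasoning
  open ℚ.+-*-Solver
  order-ℚ : fromℕ (i ℕ.* 8 ℕ.+ 8) ≡ fromℕ i * fromℕ 8 + fromℕ 8
  order-ℚ = trans (fromℕ-+ (i ℕ.* 8) 8) (cong (_+ fromℕ 8) (fromℕ-* i 8))
  evaluate : ∀ x → 5/4 * (x * fromℕ 8 + fromℕ 8) - 3ℚ ≡ fromℕ 7 + x * fromℕ 10
  evaluate = solve 1 (λ x → con 5/4 :* (x :* con (fromℕ 8) :+ con (fromℕ 8)) :- con 3ℚ
                         := con (fromℕ 7) :+ x :* con (fromℕ 10)) refl

-- Lines whose slopes differ by `δ` can keep this order only for bounded `O`. The 5 collects the 3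
-- of the lower bound and two tolerances of 1, one for `C` and one for the real inequality.
linear-gap : ∀ O δ a c .{{_ : ℚ.NonNegative O}} →
  5/4 * O - 3ℚ ≤ O * a + (c + 1ℚ) + 1ℚ → a + δ ≤ 5/4 → O * δ ≤ c + fromℕ 5
linear-gap O δ a c lower gap = begin
  O * δ                                             ≡⟨ isolate O δ ⟩
  O * δ + (5/4 * O - 3ℚ) + (3ℚ - 5/4 * O)
    ≤⟨ ℚ.+-monoˡ-≤ (3ℚ - 5/4 * O) (ℚ.+-monoʳ-≤ (O * δ) lower) ⟩
  O * δ + (O * a + (c + 1ℚ) + 1ℚ) + (3ℚ - 5/4 * O)  ≡⟨ factor O δ a c ⟩
  O * (a + δ) + (c + 1ℚ + 1ℚ) + (3ℚ - 5/4 * O)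
    ≤⟨ ℚ.+-monoˡ-≤ (3ℚ - 5/4 * O) (ℚ.+-monoˡ-≤ (c + 1ℚ + 1ℚ) (ℚ.*-monoˡ-≤-nonNeg O gap)) ⟩
  O * 5/4 + (c + 1ℚ + 1ℚ) + (3ℚ - 5/4 * O)          ≡⟨ collect O c ⟩
  c + fromℕ 5                                       ∎
  where
  open ℚ.≤-Reasoning
  open ℚ.+-*-Solver
  isolate : ∀ O δ → O * δ ≡ O * δ + (5/4 * O - 3ℚ) + (3ℚ - 5/4 * O)
  isolate = solve 2 (λ O δ → O :* δ :=
    O :* δ :+ (con 5/4 :* O :- con 3ℚ) :+ (con 3ℚ :- con 5/4 :* O)) refl
  factor : ∀ O δ a c → O * δ + (O * a + (c + 1ℚ) + 1ℚ) + (3ℚ - 5/4 * O) ≡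
                       O * (a + δ) + (c + 1ℚ + 1ℚ) + (3ℚ - 5/4 * O)
  factor = solve 4 (λ O δ a c →
    O :* δ :+ (O :* a :+ (c :+ con 1ℚ) :+ con 1ℚ) :+ (con 3ℚ :- con 5/4 :* O) :=
    O :* (a :+ δ) :+ (c :+ con 1ℚ :+ con 1ℚ) :+ (con 3ℚ :- con 5/4 :* O)) refl
  collect : ∀ O c → O * 5/4 + (c + 1ℚ + 1ℚ) + (3ℚ - 5/4 * O) ≡ c + fromℕ 5
  collect = solve 2 (λ O c →
    O :* con 5/4 :+ (c :+ con 1ℚ :+ con 1ℚ) :+ (con 3ℚ :- con 5/4 :* O) := c :+ con (fromℕ 5)) refl

-- All inequalities are read at one index past the three thresholds. That index depends on `n`, so
-- `C` is compared with its value at `L`, which makes the final constant independent of `n`.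
scaled-gap : ∀ α C δ → (∃ λ N → ∀ m → N ℕ.≤ m → seq α m + δ ≤ 5/4) →
  ∀ L → (∀ m n → L ℕ.≤ m → L ℕ.≤ n → ℚ.∣ seq C m - seq C n ∣ ≤ 1ℚ) →
  ∀ n k → 5/4 * fromℕ n - 3ℚ ≤ fromℕ k →
  (∃ λ M → ∀ m → M ℕ.≤ m → fromℕ k ≤ seq (n · α) m + seq C m + 1ℚ) →
  fromℕ n * δ ≤ seq C L + fromℕ 5
scaled-gap α C δ (N , gap) L settled n k lower (M , upper) =
  linear-gap O δ (seq α m) (seq C L) ⦃ fromℕ-nonNegative ⦄ (begin
    5/4 * O - 3ℚ                            ≤⟨ lower ⟩
    fromℕ k                                 ≤⟨ upper m M≤m ⟩
    seq (n · α) m + seq C m + 1ℚ            ≡⟨ cong (λ q → q + seq C m + 1ℚ) (seq-· n α m) ⟩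
    O * seq α m + seq C m + 1ℚ              ≤⟨ ℚ.+-monoˡ-≤ 1ℚ (ℚ.+-monoʳ-≤ (O * seq α m) C≤) ⟩
    O * seq α m + (seq C L + 1ℚ) + 1ℚ       ∎)
    (gap m N≤m)
  where
  open ℚ.≤-Reasoning
  m = N ℕ.⊔ (M ℕ.⊔ L)
  N≤m = ℕ.m≤m⊔n N (M ℕ.⊔ L)
  M≤m = ℕ.≤-trans (ℕ.m≤m⊔n M L) (ℕ.m≤n⊔m N (M ℕ.⊔ L))
  L≤m = ℕ.≤-trans (ℕ.m≤n⊔m M L) (ℕ.m≤n⊔m N (M ℕ.⊔ L))
  O = fromℕ n
  fromℕ-nonNegative : ℚ.NonNegative O
  fromℕ-nonNegative = ℚ.nonNegative (fromℕ-mono-≤ {0} {n} z≤n)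
  C≤ : seq C m ≤ seq C L + 1ℚ
  C≤ = begin
    seq C m                       ≡⟨ add-sub (seq C m) (seq C L) ⟩
    seq C L + (seq C m - seq C L) ≤⟨ ℚ.+-monoʳ-≤ (seq C L)
                                       (ℚ.≤-trans (p≤∣p∣ _) (settled m L L≤m ℕ.≤-refl)) ⟩
    seq C L + 1ℚ                  ∎
    where
    open ℚ.+-*-Solver
    add-sub : ∀ x c → x ≡ c + (x - c)
    add-sub = solve 2 (λ x c → x := c :+ (x :- c)) refl

0<1 : 0ℚ < 1ℚ
0<1 = ℚ.*<* (ℤ.+<+ (s≤s z≤n))

index≤order : ∀ i → i ℕ.≤ order (G i)
index≤order i = ℕ.≤-trans (ℕ.m≤m*n i 8)
  (ℕ.≤-trans (ℕ.m≤m+n (i ℕ.* 8) 8) (ℕ.≤-reflexive (sym (order-G i))))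

unbounded : ∀ α C → α <ᴿ fromℚ 5/4 → ¬ OPTBound (λ G → Cubic G × VertexConnected 2 G) α C
unbounded α C (δ , 0<δ , gap) bound = refute (cauchy C 1ℚ 0<1)
  where
  within : ∀ i {k} → IsOPT (G i) (source i) (target i) k → fromℚ (fromℕ k) ≤ᴿ order (G i) · α +ᴿ C
  within i isOPT = bound (G i) (cubic i , biconnected i) (source i) (target i) (λ ()) _ isOPT

  refute : ¬ ∃ λ L → ∀ m n → L ℕ.≤ m → L ℕ.≤ n → ℚ.∣ seq C m - seq C n ∣ ≤ 1ℚ
  refute (L , settled) = contradict (archimedean (seq C L + fromℕ 5) δ 0<δ)
    where
    linear : ∀ i → ∃ (IsOPT (G i) (source i) (target i)) →
             fromℕ (order (G i)) * δ ≤ seq C L + fromℕ 5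
    linear i (k , isOPT) =
      scaled-gap α C δ gap L settled (order (G i)) k (opt-bound i isOPT) (within i isOPT 1ℚ 0<1)

    -- The order of `G i` is at least `i`, so a large index violates the uniform bound.
    contradict : ¬ ∃ λ i → seq C L + fromℕ 5 < fromℕ i * δ
    contradict (i , large) = ℚ.<-irrefl refl (ℚ.<-≤-trans large (ℚ.≤-trans
      (ℚ.*-monoʳ-≤-nonNeg δ ⦃ ℚ.nonNegative (ℚ.<⇒≤ 0<δ) ⦄ (fromℕ-mono-≤ (index≤order i)))
      (linear i (shortest i))))

theorem2 : (∃ λ (C : ℚ) → ∃ λ (G : ℕ → Graph) →
    (∀ i j → i ≢ j → ¬ (G i ≅ G j)) ×
    (∀ i → Cubic (G i) × VertexConnected 2 (G i) ×
    (∃₂ λ (s t : Vertex (G i)) → Graph.Adjacent (G i) s t ×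
    (∃ λ (k : ℕ) → IsOPT (G i) s t k ×
    ((+ 5 / 4) * fromℕ (order (G i)) - C ≤ fromℕ k)))))
    ×
    (∀ (α C′ : ℝ) → α <ᴿ fromℚ (+ 5 / 4) →
    ¬ OPTBound (λ G → Cubic G × VertexConnected 2 G) α C′
    × ¬ OPTBound (λ G → Subcubic G × VertexConnected 2 G) α C′)
theorem2 =
  (3ℚ , G , non-isomorphic , λ i →
    cubic i , biconnected i , source i , target i , source~target i ,
    proj₁ (shortest i) , proj₂ (shortest i) , opt-bound i (proj₂ (shortest i))) ,
  λ α C′ α<5/4 → unbounded α C′ α<5/4 , λ bound → unbounded α C′ α<5/4
    λ G (cub , conn) → bound G ((λ v → ℕ.≤-reflexive (cub v)) , conn)
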